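{- Let $n$ and $k$ be integers with $2\leqslant k\leqslant n-1$. Then $$|\mathcal{P}_n^{k-1}[n\prec 1]|=(2n-k)\,|\mathcal{P}_n^{k}[n\prec 1]|.$$
   Context: A labeled plane tree is a rooted labeled tree in which the children of every vertex are linearly ordered. Write $[n]=\{1,\ldots,n\}$. For $1\leqslant k\leqslant n$, $\mathcal{P}_n^k$ denotes the set of forests with vertex set $[n]$ that consist of exactly $k$ labeled plane trees whose roots are $1,\ldots,k$ respectively. A vertex $y$ of a forest is a descendant of $x$, written $y\prec x$, if $x$ lies on the path from the root of the tree containing $y$ to $y$. $\mathcal{P}_n^k[n\prec 1]$ denotes the subset of those forests in $\mathcal{P}_n^k$ in which $n\prec 1$, i.e. vertex $n$ lies in the tree rooted at $1$. -}

module Defs where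

open import Data.Fin.Base using (Fin)
open import Data.List.Base using (List; []; _∷_; _++_; [_]; map; applyUpTo)
open import Data.List.Membership.Propositional using (_∈_)
open import Data.List.Relation.Binary.Permutation.Propositional using (_↭_)
open import Data.Nat.Base using (ℕ; suc)
open import Data.Product.Base using (_×_; ∃₂)
open import Data.Refinement using (Refinement-syntax; value)
open import Function.Bundles using (_↔_)
open import Relation.Binary.PropositionalEquality using (_≡_)

-- The order of the list of children is the plane structure, so two labeled
-- plane trees are equal exactly when they are propositionally equal.
data PlaneTree : Set where
  node : (label : ℕ) (children : List PlaneTree) → PlaneTree

root : PlaneTree → ℕ
root (node x _) = x

mutual
  treeLabels : PlaneTree → List ℕ
  treeLabels (node x ts) = x ∷ labels ts

  labels : List PlaneTree → List ℕ
  labels []       = []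
  labels (t ∷ ts) = treeLabels t ++ labels ts

-- Path t y p: p lists the vertices, both ends included, of a path in t from
-- its root down to y.
data Path : PlaneTree → ℕ → List ℕ → Set where
  here  : ∀ {y ts} → Path (node y ts) y [ y ]
  below : ∀ {x y t ts p} → t ∈ ts → Path t y p → Path (node x ts) y (x ∷ p)

-- F ⊢ y ≺ x: y is a descendant of x in the forest F (every vertex is a
-- descendant of itself).
_⊢_≺_ : List PlaneTree → ℕ → ℕ → Set
F ⊢ y ≺ x = ∃₂ λ t p → t ∈ F × Path t y p × x ∈ p

[1…_] : ℕ → List ℕ
[1… n ] = applyUpTo suc n

-- As the roots are distinct, a set of trees with roots 1, …, k is the same as
-- the list of these trees in increasing order of their roots. The permutation
-- condition says that each of 1, …, n labels exactly one vertex.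
IsForest : ℕ → ℕ → List PlaneTree → Set
IsForest n k F = map root F ≡ [1… k ] × labels F ↭ [1… n ]

-- Membership proofs are irrelevant in a refinement, so its elements are counted
-- by their values alone.
𝒫 : ℕ → ℕ → Set
𝒫 n k = [ F ∈ List PlaneTree ∣ IsForest n k F ]

𝒫[_≺_] : (y x n k : ℕ) → Set
𝒫[ y ≺ x ] n k = [ F ∈ 𝒫 n k ∣ value F ⊢ y ≺ x ]

∣_∣≡_ : Set → ℕ → Set
∣ A ∣≡ c = A ↔ Fin c

{-# OPTIONS --safe #-}
module Submission where

-- Cut the subtree at k out of a forest with roots 1, …, k − 1 in which n
-- descends from 1, and make it the last tree of a forest with roots 1, …, k.
-- If n was cut out with it, exchange the children of 1 and k, so that n
-- descends from 1 again. To undo this for trees T₁, …, Tₖ, either put Tₖ back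
-- anywhere in the other trees, which can be done in 2 (n − |Tₖ|) − (k − 1) ways,
-- or exchange the children of 1 and k and then put k anywhere in the tree of 1,
-- which can be done in 2 |Tₖ| − 1 ways: a vertex with c children has c + 1 places
-- for another one. So every forest with k trees arises 2 n − k times.

open import Defs
open import Data.Bool.Base using (if_then_else_)
open import Data.Fin.Base using (Fin)
open import Data.List.Base
  using (List; []; _∷_; _++_; _∷ʳ_; [_]; map; concatMap; length; lookup; applyUpTo; initLast; _∷ʳ′_)
open import Data.List.Properties
  using (++-assoc; ∷-injective; ∷-injectiveˡ; ∷-injectiveʳ; ∷ʳ-injective; length-++; length-map;
         length-applyUpTo; applyUpTo-∷ʳ; map-++)
open import Data.List.Membership.Propositional using (_∈_; _∉_; find; lose)
open import Data.List.Membership.Propositional.Properties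
open import Data.List.Relation.Binary.Permutation.Propositional
  using (_↭_; prep; ↭-refl; ↭-sym; ↭-trans; ↭⇒↭ₛ; module PermutationReasoning)
open import Data.List.Relation.Binary.Permutation.Propositional.Properties
  using (∈-resp-↭; ↭-length; shift; shifts; ∷↭∷ʳ; ++⁺ˡ; ++⁺ʳ)
open import Data.List.Relation.Binary.Disjoint.Propositional using (Disjoint)
import Data.List.Relation.Binary.Permutation.Setoid.Properties as Permutation
open import Data.List.Relation.Unary.All using ([]; _∷_)
open import Data.List.Relation.Unary.All.Properties using (¬Any⇒All¬)
open import Data.List.Relation.Unary.AllPairs using ([]; _∷_)
open import Data.List.Relation.Unary.Any using (here; there; index)
open import Data.List.Relation.Unary.Any.Properties using (lookup-index)
open import Data.List.Relation.Unary.Unique.Propositional using (Unique)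
open import Data.List.Relation.Unary.Unique.Propositional.Properties
  using (Unique[x∷xs]⇒x∉xs; applyUpTo⁺₁) renaming (map⁺ to map-unique; ++⁺ to ++-unique)
open import Data.Nat.Base
open import Data.Nat.Properties
open import Data.Nat.Solver using (module +-*-Solver)
open import Data.Product.Base using (Σ; _×_; _,_; proj₁; proj₂; ∃; ∃₂)
open import Data.Refinement using (value) renaming (_,_ to _,ᵣ_)
open import Data.Irrelevant using () renaming ([_] to irr)
open import Data.Sum.Base as Sum using (_⊎_; inj₁; inj₂)
open import Function.Base using (_∘_; case_of_)
open import Function.Bundles using (mk↔ₛ′)
open import Relation.Binary.Definitions using (DecidableEquality)
open import Relation.Binary.PropositionalEquality hiding ([_])
open import Relation.Nullary using (yes; no; does; contradiction; recompute)
open import Relation.Nullary.Decidable using (dec-true; dec-false; map′; _×-dec_)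
open +-*-Solver using (solve; _:+_; _:*_; _:=_; con)

-- Decidable equality of trees and forests

Forest : Set
Forest = List PlaneTree

node-injective : ∀ {x y ts us} → node x ts ≡ node y us → x ≡ y × ts ≡ us
node-injective refl = refl , refl

mutual
  -- Refinements keep their proofs irrelevant, so `enum-card` has to recover membership in an
  -- enumeration by deciding it.
  _≟ᵗ_ : DecidableEquality PlaneTree
  node x ts ≟ᵗ node y us =
    map′ (λ { (refl , refl) → refl }) node-injective ((x ≟ y) ×-dec (ts ≟ᶠ us))

  _≟ᶠ_ : DecidableEquality Forest
  []       ≟ᶠ []       = yes refl
  []       ≟ᶠ (_ ∷ _)  = no λ ()
  (_ ∷ _)  ≟ᶠ []       = no λ ()
  (t ∷ ts) ≟ᶠ (u ∷ us) = map′ (λ { (refl , refl) → refl }) ∷-injective ((t ≟ᵗ u) ×-dec (ts ≟ᶠ us))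

open import Data.List.Membership.DecPropositional _≟ᶠ_ using (_∈?_)

-- Inserting a tree into a forest

-- The children of a vertex form a forest themselves, so one relation covers a new tree of the
-- forest and a new child at any depth.
data Inserted (t : PlaneTree) : Forest → Forest → Set where
  front : ∀ {F} → Inserted t F (t ∷ F)
  down  : ∀ {x ts us F} → Inserted t ts us → Inserted t (node x ts ∷ F) (node x us ∷ F)
  next  : ∀ {u F G} → Inserted t F G → Inserted t (u ∷ F) (u ∷ G)

insertions : PlaneTree → Forest → List Forest
insertions t []              = [ [ t ] ]
insertions t (node x ts ∷ F) =
  (t ∷ node x ts ∷ F) ∷
  map (λ us → node x us ∷ F) (insertions t ts) ++ map (node x ts ∷_) (insertions t F)

-- Here `t` must land below an existing vertex, so the list of roots stays the same.
properInsertions : PlaneTree → Forest → List Forest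
properInsertions t []              = []
properInsertions t (node x ts ∷ F) =
  map (λ us → node x us ∷ F) (insertions t ts) ++ map (node x ts ∷_) (properInsertions t F)

length-down++next : ∀ x ts F (uss Gs : List Forest) →
                    length (map (λ us → node x us ∷ F) uss ++ map (node x ts ∷_) Gs) ≡ length uss + length Gs
length-down++next x ts F uss Gs =
  trans (length-++ (map _ uss)) (cong₂ _+_ (length-map _ uss) (length-map _ Gs))

∈-down++next⁻ : ∀ {x ts F G} (uss Gs : List Forest) →
                G ∈ map (λ us → node x us ∷ F) uss ++ map (node x ts ∷_) Gs →
                (∃ λ us → us ∈ uss × G ≡ node x us ∷ F) ⊎ (∃ λ H → H ∈ Gs × G ≡ node x ts ∷ H)
∈-down++next⁻ uss Gs = Sum.map (∈-map⁻ _) (∈-map⁻ _) ∘ ∈-++⁻ (map _ uss)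

∈-insertions⁺ : ∀ {t F G} → Inserted t F G → G ∈ insertions t F
∈-insertions⁺ {F = []}            front    = here refl
∈-insertions⁺ {F = node _ _ ∷ _} front    = here refl
∈-insertions⁺ {F = node x _ ∷ F} (down i) = there (∈-++⁺ˡ (∈-map⁺ (λ us → node x us ∷ F) (∈-insertions⁺ i)))
∈-insertions⁺ {F = node _ _ ∷ _} (next i) = there (∈-++⁺ʳ _ (∈-map⁺ _ (∈-insertions⁺ i)))

∈-insertions⁻ : ∀ {t G} F → G ∈ insertions t F → Inserted t F G
∈-insertions⁻ []               (here refl) = front
∈-insertions⁻ (node _ _ ∷ _)  (here refl) = front
∈-insertions⁻ (node _ ts ∷ F) (there G∈) with ∈-down++next⁻ (insertions _ ts) _ G∈
... | inj₁ (_ , us∈ , refl) = down (∈-insertions⁻ ts us∈)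
... | inj₂ (_ , H∈ , refl)  = next (∈-insertions⁻ F H∈)

∈-properInsertions⁺ : ∀ {t F G} → Inserted t F G → map root G ≡ map root F → G ∈ properInsertions t F
∈-properInsertions⁺ {F = F} front roots =
  contradiction (trans (cong length roots) (length-map root F)) (1+n≢n ∘ trans (cong suc (sym (length-map root F))))
∈-properInsertions⁺ {F = node x _ ∷ F} (down i) _ =
  ∈-++⁺ˡ (∈-map⁺ (λ us → node x us ∷ F) (∈-insertions⁺ i))
∈-properInsertions⁺ {F = node _ _ ∷ _} (next i) roots =
  ∈-++⁺ʳ _ (∈-map⁺ _ (∈-properInsertions⁺ i (∷-injectiveʳ roots)))

∈-properInsertions⁻ : ∀ {t G} F → G ∈ properInsertions t F → Inserted t F G × map root G ≡ map root F
∈-properInsertions⁻ (node _ ts ∷ F) G∈ with ∈-down++next⁻ (insertions _ ts) _ G∈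
... | inj₁ (_ , us∈ , refl) = down (∈-insertions⁻ ts us∈) , refl
... | inj₂ (_ , H∈ , refl) with i , roots ← ∈-properInsertions⁻ F H∈ =
  next i , cong (_ ∷_) roots

-- A vertex with c children offers c + 1 places, and the top level one more than it has trees. In
-- the sum each vertex counts twice, once as a parent and once as a child or root; the last place of
-- the top level is the extra 1.
length-insertions : ∀ t F → length (insertions t F) ≡ 1 + 2 * length (labels F)
length-insertions t []              = refl
length-insertions t (node x ts ∷ F)
  rewrite length-down++next x ts F (insertions t ts) (insertions t F)
        | length-insertions t ts | length-insertions t F
        | length-++ (labels ts) {labels F} =
  solve 2 (λ a b → con 1 :+ ((con 1 :+ con 2 :* a) :+ (con 1 :+ con 2 :* b))
                := con 1 :+ con 2 :* (con 1 :+ (a :+ b))) refl (length (labels ts)) (length (labels F))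

-- The 1 + `length F` places of the top level are dropped from the previous count. The additive form
-- avoids truncated subtraction.
length-properInsertions : ∀ t F → length (properInsertions t F) + length F ≡ 2 * length (labels F)
length-properInsertions t []              = refl
length-properInsertions t (node x ts ∷ F)
  rewrite length-down++next x ts F (insertions t ts) (properInsertions t F)
        | length-insertions t ts
        | length-++ (labels ts) {labels F} = begin
  (1 + 2 * a) + p + suc (length F)   ≡⟨ solve 3 (λ a p l → (con 1 :+ con 2 :* a) :+ p :+ (con 1 :+ l)
                                          := (con 2 :+ con 2 :* a) :+ (p :+ l)) refl a p (length F) ⟩
  (2 + 2 * a) + (p + length F)       ≡⟨ cong ((2 + 2 * a) +_) (length-properInsertions t F) ⟩
  (2 + 2 * a) + 2 * b                ≡⟨ solve 2 (λ a b → (con 2 :+ con 2 :* a) :+ con 2 :* b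
                                          := con 2 :* (con 1 :+ (a :+ b))) refl a b ⟩
  2 * suc (a + b)                    ∎
  where
  open ≡-Reasoning
  a = length (labels ts)
  b = length (labels F)
  p = length (properInsertions t F)

labels-inserted : ∀ {t F G} → Inserted t F G → labels G ↭ treeLabels t ++ labels F
labels-inserted front = ↭-refl
labels-inserted {t} (down {x} {ts} {us} {F} i) = begin
  x ∷ labels us ++ labels F                     ↭⟨ prep x (++⁺ʳ (labels F) (labels-inserted i)) ⟩
  x ∷ (treeLabels t ++ labels ts) ++ labels F   ≡⟨ cong (x ∷_) (++-assoc (treeLabels t) _ _) ⟩
  x ∷ treeLabels t ++ labels ts ++ labels F     ↭⟨ shift x (treeLabels t) _ ⟨
  treeLabels t ++ x ∷ labels ts ++ labels F     ∎
  where open PermutationReasoning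
labels-inserted {t} (next {u} {F} {G} i) = begin
  treeLabels u ++ labels G                   ↭⟨ ++⁺ˡ (treeLabels u) (labels-inserted i) ⟩
  treeLabels u ++ treeLabels t ++ labels F   ↭⟨ shifts (treeLabels u) (treeLabels t) ⟩
  treeLabels t ++ treeLabels u ++ labels F   ∎
  where open PermutationReasoning

-- An inserted tree brings at least its root, so the number of labels grows.
inserted≢ : ∀ {t F G} → Inserted t F G → G ≢ F
inserted≢ {node x ts} {F} i refl = <⇒≢ (s≤s (m≤n+m _ _))
  (trans (↭-length (labels-inserted i)) (cong suc (length-++ (labels ts))))

∷ʳ-inserted : ∀ t F → Inserted t F (F ∷ʳ t)
∷ʳ-inserted t []      = front
∷ʳ-inserted t (u ∷ F) = next (∷ʳ-inserted t F)

roots-inserted : ∀ {k ts F G} → Inserted (node k ts) F G → k ∉ map root G → map root G ≡ map root F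
roots-inserted front    k∉ = contradiction (here refl) k∉
roots-inserted (down i) k∉ = refl
roots-inserted (next i) k∉ = cong (_ ∷_) (roots-inserted i (k∉ ∘ there))

-- This is the cut: `node k ts` is the subtree at a vertex `k`, and `F` is what remains of `G`.
∈-labels⇒inserted : ∀ {k} G → k ∈ labels G → ∃₂ λ ts F → Inserted (node k ts) F G
∈-labels⇒inserted (node x us ∷ G) (here refl) = us , G , front
∈-labels⇒inserted (node x us ∷ G) (there k∈) with ∈-++⁻ (labels us) k∈
... | inj₁ k∈us with ts , _ , i ← ∈-labels⇒inserted us k∈us = ts , _ , down i
... | inj₂ k∈G  with ts , _ , i ← ∈-labels⇒inserted G k∈G   = ts , _ , next i

-- Inverse to inserting a tree with the new root label k, hence what shows that
-- different insertions have different results.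
extract : ℕ → Forest → Forest × Forest
extract k []              = [] , []
extract k (node x ts ∷ F) =
  if does (x ≟ k)
  then (node x ts ∷ proj₁ (extract k F) , proj₂ (extract k F))
  else (proj₁ (extract k ts) ++ proj₁ (extract k F) , node x (proj₂ (extract k ts)) ∷ proj₂ (extract k F))

extract-fresh : ∀ {k} F → k ∉ labels F → extract k F ≡ ([] , F)
extract-fresh         []              k∉ = refl
extract-fresh {k} (node x ts ∷ F) k∉
  rewrite dec-false (x ≟ k) (λ x≡k → k∉ (here (sym x≡k)))
        | extract-fresh ts (k∉ ∘ there ∘ ∈-++⁺ˡ)
        | extract-fresh F (k∉ ∘ there ∘ ∈-++⁺ʳ (labels ts)) = refl

-- `extract` removes a tree with root `k` as a whole without searching below it, so freshness of `k`
-- in `F` makes the inserted tree the only one found.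
extract-inserted : ∀ {k ts F G} → Inserted (node k ts) F G → k ∉ labels F → extract k G ≡ ([ node k ts ] , F)
extract-inserted {k} {F = F} front k∉
  rewrite dec-true (k ≟ k) refl | extract-fresh F k∉ = refl
extract-inserted {k} (down {x} {vs} {F = F} i) k∉
  rewrite dec-false (x ≟ k) (λ x≡k → k∉ (here (sym x≡k)))
        | extract-inserted i (k∉ ∘ there ∘ ∈-++⁺ˡ)
        | extract-fresh F (k∉ ∘ there ∘ ∈-++⁺ʳ (labels vs)) = refl
extract-inserted {k} (next {node x vs} i) k∉
  rewrite dec-false (x ≟ k) (λ x≡k → k∉ (here (sym x≡k)))
        | extract-fresh vs (k∉ ∘ there ∘ ∈-++⁺ˡ)
        | extract-inserted i (k∉ ∘ there ∘ ∈-++⁺ʳ (labels vs)) = refl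

-- A forest in both parts would have first tree `node x ts` and thus put `ts` into `uss`. For
-- insertions `inserted≢` rules this out.
down++next-unique : ∀ {x ts F} {uss Gs : List Forest} → Unique uss → Unique Gs → ts ∉ uss →
                    Unique (map (λ us → node x us ∷ F) uss ++ map (node x ts ∷_) Gs)
down++next-unique {ts = ts} {uss = uss} uss! Gs! ts∉ = ++-unique
  (map-unique (proj₂ ∘ node-injective ∘ ∷-injectiveˡ) uss!) (map-unique ∷-injectiveʳ Gs!) disjoint
  where
  disjoint : Disjoint (map _ uss) (map _ _)
  disjoint (H∈ , H∈′) with us , us∈ , refl ← ∈-map⁻ _ H∈ with _ , _ , eq ← ∈-map⁻ _ H∈′ =
    ts∉ (subst (_∈ uss) (proj₂ (node-injective (∷-injectiveˡ eq))) us∈)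

insertions-unique : ∀ {k ts} F → k ∉ labels F → Unique (insertions (node k ts) F)
insertions-unique          []              k∉ = [] ∷ []
insertions-unique {k} {ts} (node x us ∷ F) k∉ =
  ¬Any⇒All¬ _ front∉ ∷
  down++next-unique (insertions-unique us (k∉ ∘ there ∘ ∈-++⁺ˡ))
                    (insertions-unique F (k∉ ∘ there ∘ ∈-++⁺ʳ (labels us)))
                    (λ us∈ → inserted≢ (∈-insertions⁻ us us∈) refl)
  where
  front∉ : (node k ts ∷ node x us ∷ F) ∉ map (λ vs → node x vs ∷ F) (insertions (node k ts) us) ++
                                          map (node x us ∷_) (insertions (node k ts) F)
  front∉ front∈ with ∈-down++next⁻ (insertions _ us) _ front∈
  -- The tails would be `node x us ∷ F` and `F`.
  ... | inj₁ (_ , _ , ())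
  -- Equal first trees would make the fresh label `k` equal to `x`.
  ... | inj₂ (_ , _ , refl) = k∉ (here refl)

properInsertions-unique : ∀ {k ts} F → k ∉ labels F → Unique (properInsertions (node k ts) F)
properInsertions-unique []              k∉ = []
properInsertions-unique (node x us ∷ F) k∉ =
  down++next-unique (insertions-unique us (k∉ ∘ there ∘ ∈-++⁺ˡ))
                    (properInsertions-unique F (k∉ ∘ there ∘ ∈-++⁺ʳ (labels us)))
                    (λ us∈ → inserted≢ (∈-insertions⁻ us us∈) refl)

-- Finite sets as enumerations

-- Counting is done with lengths of such lists; `enum-card` turns them into bijections with `Fin`
-- only at the end.
record Enum {A : Set} (P : A → Set) : Set where
  field
    list     : List A
    unique   : Unique list
    sound    : ∀ {x} → x ∈ list → P x
    complete : ∀ {x} → P x → x ∈ list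

open Enum

enum-⇔ : {A : Set} {P Q : A → Set} → (∀ {x} → P x → Q x) → (∀ {x} → Q x → P x) → Enum P → Enum Q
enum-⇔ P⇒Q Q⇒P e = record
  { list = list e ; unique = unique e ; sound = P⇒Q ∘ sound e ; complete = complete e ∘ Q⇒P }

concatMap-unique : {A B : Set} (f : A → List B) {xs : List A} → Unique xs →
                   (∀ {x} → x ∈ xs → Unique (f x)) →
                   (∀ {x y z} → x ∈ xs → y ∈ xs → z ∈ f x → z ∈ f y → x ≡ y) →
                   Unique (concatMap f xs)
concatMap-unique f          []                f! f-disjoint = []
concatMap-unique f {x ∷ xs} xs!@(_ ∷ xs!′) f! f-disjoint = ++-unique (f! (here refl))
  (concatMap-unique f xs!′ (f! ∘ there) (λ x∈ y∈ → f-disjoint (there x∈) (there y∈)))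
  λ (z∈ , z∈′) → case find (∈-concatMap⁻ f z∈′) of λ (y , y∈ , z∈fy) →
    Unique[x∷xs]⇒x∉xs xs! (subst (_∈ xs) (f-disjoint (there y∈) (here refl) z∈fy z∈) y∈)

length-concatMap : {A B : Set} (f : A → List B) {c : ℕ} (xs : List A) →
                   (∀ {x} → x ∈ xs → length (f x) ≡ c) → length (concatMap f xs) ≡ c * length xs
length-concatMap f {c} []       len = sym (*-zeroʳ c)
length-concatMap f {c} (x ∷ xs) len = begin
  length (f x ++ concatMap f xs)           ≡⟨ length-++ (f x) ⟩
  length (f x) + length (concatMap f xs)   ≡⟨ cong₂ _+_ (len (here refl)) (length-concatMap f xs (len ∘ there)) ⟩
  c + c * length xs                        ≡⟨ *-suc c (length xs) ⟨
  c * suc (length xs)                      ∎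
  where open ≡-Reasoning

index-lookup : {A : Set} {xs : List A} → Unique xs → ∀ i (x∈ : lookup xs i ∈ xs) → index x∈ ≡ i
index-lookup xs!        Fin.zero    (here _)   = refl
index-lookup xs!        Fin.zero    (there x∈) = contradiction x∈ (Unique[x∷xs]⇒x∉xs xs!)
index-lookup xs!        (Fin.suc i) (here eq)  =
  contradiction (subst (_∈ _) eq (∈-lookup i)) (Unique[x∷xs]⇒x∉xs xs!)
index-lookup (_ ∷ xs!) (Fin.suc i) (there x∈) = cong Fin.suc (index-lookup xs! i x∈)

enum-card : ∀ {n k y x} (e : Enum (λ F → IsForest n k F × F ⊢ y ≺ x)) → ∣ 𝒫[ y ≺ x ] n k ∣≡ length (list e)
enum-card {n} {k} {y} {x} e = mk↔ₛ′ to from to∘from from∘to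
  where
  member : (F : 𝒫[ y ≺ x ] n k) → value (value F) ∈ list e
  member ((F ,ᵣ irr isForest) ,ᵣ irr descends) = recompute (F ∈? list e)
    (complete e (isForest , descends))

  to : 𝒫[ y ≺ x ] n k → Fin (length (list e))
  to F = index (member F)

  from : Fin (length (list e)) → 𝒫[ y ≺ x ] n k
  from i = (lookup (list e) i ,ᵣ irr (proj₁ p)) ,ᵣ irr (proj₂ p)
    where p = sound e (∈-lookup i)

  to∘from : ∀ i → to (from i) ≡ i
  to∘from i = index-lookup (unique e) i (member (from i))

  value-injective : ∀ {F G : 𝒫[ y ≺ x ] n k} → value (value F) ≡ value (value G) → F ≡ G
  value-injective {(_ ,ᵣ _) ,ᵣ _} {(_ ,ᵣ _) ,ᵣ _} refl = refl

  from∘to : ∀ F → from (to F) ≡ F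
  from∘to F = value-injective (sym (lookup-index (member F)))

-- Forests with roots 1, …, 1 + m in which n descends from 1

data Anchored (n m : ℕ) : Forest → Set where
  anchored : ∀ {cs F} → map root F ≡ applyUpTo (2 +_) m → 1 ∷ labels cs ++ labels F ↭ [1… n ] →
             n ∈ labels cs → Anchored n m (node 1 cs ∷ F)

[1…]-unique : ∀ n → Unique [1… n ]
[1…]-unique n = applyUpTo⁺₁ suc n (λ i<j _ → <⇒≢ i<j ∘ suc-injective)

unique-resp-↭ : ∀ {xs ys : List ℕ} → xs ↭ ys → Unique ys → Unique xs
unique-resp-↭ xs↭ys = Permutation.Unique-resp-↭ (setoid ℕ) (↭⇒↭ₛ (↭-sym xs↭ys))

++-unique⁻ : ∀ {A : Set} {x : A} (xs : List A) {ys} → Unique (xs ++ ys) → x ∈ xs → x ∉ ys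
++-unique⁻ (x ∷ xs) xys!       (here refl) = Unique[x∷xs]⇒x∉xs xys! ∘ ∈-++⁺ʳ xs
++-unique⁻ (x ∷ xs) (_ ∷ xys!) (there x∈)  = ++-unique⁻ xs xys! x∈

mutual
  path⇒∈ : ∀ {t y z p} → Path t y p → z ∈ p → z ∈ treeLabels t
  path⇒∈ here          (here refl) = here refl
  path⇒∈ (below t∈ π) (here refl) = here refl
  path⇒∈ (below t∈ π) (there z∈)  = there (∈-labels t∈ (path⇒∈ π z∈))

  ∈-labels : ∀ {t F z} → t ∈ F → z ∈ treeLabels t → z ∈ labels F
  ∈-labels         (here refl) z∈ = ∈-++⁺ˡ z∈
  ∈-labels {F = u ∷ _} (there t∈)  z∈ = ∈-++⁺ʳ (treeLabels u) (∈-labels t∈ z∈)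

end∈path : ∀ {t y p} → Path t y p → y ∈ p
end∈path here        = here refl
end∈path (below _ π) = there (end∈path π)

mutual
  -- The path displays its first vertex, so that `anchored⇒descends` sees 1 on it.
  ∈⇒path : ∀ {y} t → y ∈ treeLabels t → ∃ λ p → Path t y (root t ∷ p)
  ∈⇒path (node x ts) (here refl) = [] , here
  ∈⇒path (node x ts) (there y∈) with _ , p , t∈ , π ← ∈⇒path-below ts y∈ = p , below t∈ π

  ∈⇒path-below : ∀ {y} F → y ∈ labels F → ∃₂ λ t p → t ∈ F × Path t y p
  ∈⇒path-below (t ∷ F) y∈ with ∈-++⁻ (treeLabels t) y∈
  ... | inj₁ y∈t with p , π ← ∈⇒path t y∈t                    = t , root t ∷ p , here refl , π
  ... | inj₂ y∈F with u , p , u∈ , π ← ∈⇒path-below F y∈F     = u , p , there u∈ , π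

anchored⇒descends : ∀ {n m F} → Anchored n m F → IsForest n (suc m) F × F ⊢ n ≺ 1
anchored⇒descends (anchored {cs} roots perm n∈) with p , π ← ∈⇒path (node 1 cs) (there n∈) =
  (cong (1 ∷_) roots , perm) , node 1 cs , 1 ∷ p , here refl , π , here refl

-- The label 1 occurs only once, as the first root, so a path through 1 lies in the first tree; as
-- `n ≢ 1`, its end is strictly below the root.
descends⇒anchored : ∀ {n m F} → n ≢ 1 → IsForest n (suc m) F × F ⊢ n ≺ 1 → Anchored n m F
descends⇒anchored {n} {F = node x cs ∷ F} n≢1 ((roots , perm) , t , p , t∈ , π , 1∈p)
  with refl ← ∷-injectiveˡ roots = anchored (∷-injectiveʳ roots) perm (n∈cs t∈)
  where
  n∈cs : t ∈ node 1 cs ∷ F → n ∈ labels cs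
  n∈cs (here refl) with path⇒∈ π (end∈path π)
  ... | here n≡1   = contradiction n≡1 n≢1
  ... | there n∈cs = n∈cs
  n∈cs (there t∈F) = contradiction (∈-labels t∈F (path⇒∈ π 1∈p))
    (++-unique⁻ (treeLabels (node 1 cs)) (unique-resp-↭ perm ([1…]-unique n)) (here refl))

-- Cutting and reattaching the tree of k = 2 + m

-- Describes the forest join (2 + m) cs F ds.
record Split (n m : ℕ) (cs F ds : Forest) : Set where
  constructor split
  field
    roots : map root F ≡ applyUpTo (2 +_) m
    perm  : treeLabels (node (2 + m) ds) ++ treeLabels (node 1 cs) ++ labels F ↭ [1… n ]
    n∈    : n ∈ labels cs

  perm-unique : Unique ((2 + m) ∷ labels ds ++ 1 ∷ labels cs ++ labels F)
  perm-unique = unique-resp-↭ perm ([1…]-unique n)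

  -- This tells the two kinds of reattachment apart: the tree cut out at `k` contains `n` exactly
  -- after an exchange.
  n∉ds : n ∉ labels ds
  n∉ds n∈ds = ++-unique⁻ (treeLabels (node (2 + m) ds)) perm-unique (there n∈ds) (there (∈-++⁺ˡ n∈))

  k∉ : 2 + m ∉ labels (node 1 cs ∷ F)
  k∉ = ++-unique⁻ (treeLabels (node (2 + m) ds)) perm-unique (here refl)

  -- The counterpart of `k∉` after the exchange, when `ds` hangs below 1.
  k∉′ : 2 + m ∉ labels (node 1 ds ∷ F)
  k∉′ (here ())
  k∉′ (there k∈) with ∈-++⁻ (labels ds) k∈
  ... | inj₁ k∈ds = Unique[x∷xs]⇒x∉xs perm-unique (∈-++⁺ˡ k∈ds)
  ... | inj₂ k∈F  = k∉ (there (∈-++⁺ʳ (labels cs) k∈F))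

join : ℕ → Forest → Forest → Forest → Forest
join k cs F ds = node 1 cs ∷ F ∷ʳ node k ds

split⇒anchored : ∀ {n m cs F ds} → Split n m cs F ds → Anchored n (suc m) (join (2 + m) cs F ds)
split⇒anchored {n} {m} {cs} {F} {ds} (split roots perm n∈) = anchored
  (begin
    map root (F ∷ʳ node (2 + m) ds)   ≡⟨ map-++ root F _ ⟩
    map root F ∷ʳ (2 + m)             ≡⟨ cong (_∷ʳ (2 + m)) roots ⟩
    applyUpTo (2 +_) m ∷ʳ (2 + m)     ≡⟨ applyUpTo-∷ʳ (2 +_) m ⟩
    applyUpTo (2 +_) (suc m)          ∎)
  (↭-trans (labels-inserted (∷ʳ-inserted (node (2 + m) ds) (node 1 cs ∷ F))) perm) n∈
  where open ≡-Reasoning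

anchored⇒split : ∀ {n m G} → Anchored n (suc m) G →
                 ∃ λ cs → ∃₂ λ F ds → G ≡ join (2 + m) cs F ds × Split n m cs F ds
anchored⇒split {m = m} (anchored {cs} {G} roots perm n∈) with initLast G
-- An empty `G` is excluded by `roots`, and the next lines force the last root to be 2 + `m`.
... | F ∷ʳ′ node k ds
  with roots′ , refl ← ∷ʳ-injective (map root F) (applyUpTo (2 +_) m)
                         (trans (sym (map-++ root F _)) (trans roots (sym (applyUpTo-∷ʳ (2 +_) m)))) =
  cs , F , ds , refl ,
  split roots′ (↭-trans (↭-sym (labels-inserted (∷ʳ-inserted (node k ds) (node 1 cs ∷ F)))) perm) n∈

reattachments : ℕ → Forest → Forest → Forest → List Forest
reattachments k cs F ds =
  properInsertions (node k ds) (node 1 cs ∷ F) ++ map (λ us → node 1 us ∷ F) (insertions (node k cs) ds)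

-- `concatMap` asks for a function on all forests. The empty values belong to forests with fewer
-- than two trees, and no `join` is among these.
reattach : ℕ → Forest → List Forest
reattach k []              = []
reattach k (node _ cs ∷ G) with initLast G
... | []               = []
... | F ∷ʳ′ node _ ds = reattachments k cs F ds

reattach-join : ∀ k cs F ds → reattach k (join k cs F ds) ≡ reattachments k cs F ds
reattach-join k cs F ds = go F _ refl
  where
  -- `G` is a variable, so that the view `initLast G` can be matched on.
  go : ∀ F G → G ≡ F ∷ʳ node k ds → reattach k (node 1 cs ∷ G) ≡ reattachments k cs F ds
  go F       G eq with initLast G
  go F       _ eq | H ∷ʳ′ node _ _ with refl , refl ← ∷ʳ-injective H F eq = refl
  go []      _ () | []
  go (_ ∷ _) _ () | []

-- In the first case n stays outside the tree of k; in the second that tree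
-- carries the children of 1 along with n.
data Reattached (k : ℕ) (cs F ds : Forest) : Forest → Set where
  stay : ∀ {G} → Inserted (node k ds) (node 1 cs ∷ F) G → map root G ≡ 1 ∷ map root F →
         Reattached k cs F ds G
  swap : ∀ {us} → Inserted (node k cs) ds us → Reattached k cs F ds (node 1 us ∷ F)

∈-reattachments⁺ : ∀ {k cs F ds G} → Reattached k cs F ds G → G ∈ reattachments k cs F ds
∈-reattachments⁺         (stay i roots) = ∈-++⁺ˡ (∈-properInsertions⁺ i roots)
∈-reattachments⁺ {k} {cs} {F} {ds} (swap i) =
  ∈-++⁺ʳ (properInsertions (node k ds) (node 1 cs ∷ F)) (∈-map⁺ (λ us → node 1 us ∷ F) (∈-insertions⁺ i))

∈-reattachments⁻ : ∀ {k cs F ds G} → G ∈ reattachments k cs F ds → Reattached k cs F ds G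
∈-reattachments⁻ {k} {cs} {F} {ds} G∈ with ∈-++⁻ (properInsertions (node k ds) (node 1 cs ∷ F)) G∈
... | inj₁ G∈ˡ with i , roots ← ∈-properInsertions⁻ (node 1 cs ∷ F) G∈ˡ = stay i roots
... | inj₂ G∈ʳ with _ , us∈ , refl ← ∈-map⁻ (λ us → node 1 us ∷ F) G∈ʳ = swap (∈-insertions⁻ ds us∈)

exchange-↭ : ∀ k cs F ds → 1 ∷ (treeLabels (node k cs) ++ labels ds) ++ labels F ↭
             treeLabels (node k ds) ++ treeLabels (node 1 cs) ++ labels F
exchange-↭ k cs F ds = begin
  1 ∷ k ∷ (labels cs ++ labels ds) ++ labels F      ≡⟨ cong (λ xs → 1 ∷ k ∷ xs) (++-assoc (labels cs) _ _) ⟩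
  1 ∷ k ∷ labels cs ++ labels ds ++ labels F        ↭⟨ prep 1 (prep k (shifts (labels cs) (labels ds))) ⟩
  1 ∷ k ∷ labels ds ++ labels cs ++ labels F        ↭⟨ shift 1 (k ∷ labels ds) _ ⟨
  k ∷ labels ds ++ 1 ∷ labels cs ++ labels F        ∎
  where open PermutationReasoning

reattached-anchored : ∀ {n m cs F ds G} → Split n m cs F ds → Reattached (2 + m) cs F ds G → Anchored n m G
reattached-anchored {n} {m} {cs} {F} {ds} (split roots perm n∈) = λ where
    -- The first root would be 2 + `m` instead of 1.
    (stay front roots′) → case ∷-injectiveˡ roots′ of λ ()
    (stay (down i) roots′) →
      anchored roots (↭-trans (labels-inserted {F = node 1 cs ∷ F} (down i)) perm)
        (∈-resp-↭ (↭-sym (labels-inserted i)) (∈-++⁺ʳ _ n∈))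
    (stay (next i) roots′) →
      anchored (trans (∷-injectiveʳ roots′) roots)
        (↭-trans (labels-inserted {F = node 1 cs ∷ F} (next i)) perm) n∈
    -- Now `n` lies in `cs`, hence below `k`, which lies below 1.
    (swap i) →
      anchored roots
        (↭-trans (prep 1 (++⁺ʳ (labels F) (labels-inserted i))) (↭-trans (exchange-↭ (2 + m) cs F ds) perm))
        (∈-resp-↭ (↭-sym (labels-inserted i)) (there (∈-++⁺ˡ n∈)))

k∉applyUpTo : ∀ m → 2 + m ∉ applyUpTo (2 +_) m
k∉applyUpTo m k∈ with _ , i<m , refl ← ∈-applyUpTo⁻ (2 +_) k∈ = <-irrefl refl i<m

-- The vertex k = 2 + `m` lies in another tree, or below 1 with `n` in its subtree, or below 1
-- without it. Only the second case needs the exchange. The bound makes k a vertex different from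
-- `n`.
anchored-reattached : ∀ {n m G} → 2 + m < n → Anchored n m G →
                      ∃ λ cs → ∃₂ λ F ds → Split n m cs F ds × Reattached (2 + m) cs F ds G
anchored-reattached {n} {m} k<n (anchored {us} {H} roots perm n∈)
  with ∈-resp-↭ (↭-sym perm) (∈-applyUpTo⁺ suc (<-trans (n<1+n _) k<n))
... | there k∈ with ∈-++⁻ (labels us) k∈
...   | inj₂ k∈H with ds , F , i ← ∈-labels⇒inserted H k∈H
  with roots′ ← roots-inserted i (subst (2 + m ∉_) (sym roots) (k∉applyUpTo m)) =
  us , F , ds ,
  split (trans (sym roots′) roots) (↭-trans (↭-sym (labels-inserted {F = node 1 us ∷ F} (next i))) perm) n∈ ,
  stay (next i) (cong (1 ∷_) roots′)
...   | inj₁ k∈us with ds , cs , i ← ∈-labels⇒inserted us k∈us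
  with ∈-++⁻ (treeLabels (node (2 + m) ds)) (∈-resp-↭ (labels-inserted i) n∈)
...     | inj₁ (here refl) = contradiction k<n (<-irrefl refl)
-- The subtree at k took `n` along, so its children `ds` go to 1 and the remaining children `cs` of
-- 1 go to k.
...     | inj₁ (there n∈ds) =
  ds , H , cs ,
  split roots (↭-trans (↭-sym (exchange-↭ (2 + m) ds H cs))
                (↭-trans (↭-sym (prep 1 (++⁺ʳ (labels H) (labels-inserted i)))) perm)) n∈ds ,
  swap i
...     | inj₂ n∈cs =
  cs , H , ds ,
  split roots (↭-trans (↭-sym (labels-inserted {F = node 1 cs ∷ H} (down i))) perm) n∈cs ,
  stay (down i) refl

-- Distinctness and number of the reattached forests

extract-stay : ∀ {n m cs F ds G} → Split n m cs F ds → Inserted (node (2 + m) ds) (node 1 cs ∷ F) G →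
               extract (2 + m) G ≡ ([ node (2 + m) ds ] , node 1 cs ∷ F)
extract-stay s i = extract-inserted i (Split.k∉ s)

extract-swap : ∀ {n m cs F ds us} → Split n m cs F ds → Inserted (node (2 + m) cs) ds us →
               extract (2 + m) (node 1 us ∷ F) ≡ ([ node (2 + m) cs ] , node 1 ds ∷ F)
extract-swap s i = extract-inserted (down i) (Split.k∉′ s)

-- Extracting the tree at 2 + `m` from `G` recovers all the data if both reattachments are of the
-- same kind. If not, `n` would lie both inside and outside the extracted tree.
reattached-injective : ∀ {n m cs cs′ F F′ ds ds′ G} → Split n m cs F ds → Split n m cs′ F′ ds′ →
  Reattached (2 + m) cs F ds G → Reattached (2 + m) cs′ F′ ds′ G → (cs , F , ds) ≡ (cs′ , F′ , ds′)
reattached-injective s s′ (stay i _) (stay i′ _)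
  with refl ← trans (sym (extract-stay s i)) (extract-stay s′ i′) = refl
reattached-injective s s′ (swap i) (swap i′)
  with refl ← trans (sym (extract-swap s i)) (extract-swap s′ i′) = refl
reattached-injective s s′ (stay i _) (swap i′)
  with refl ← trans (sym (extract-stay s i)) (extract-swap s′ i′) =
  contradiction (Split.n∈ s′) (Split.n∉ds s)
reattached-injective s s′ (swap i) (stay i′ _)
  with refl ← trans (sym (extract-swap s i)) (extract-stay s′ i′) =
  contradiction (Split.n∈ s) (Split.n∉ds s′)

reattachments-unique : ∀ {n m cs F ds} → Split n m cs F ds → Unique (reattachments (2 + m) cs F ds)
reattachments-unique {m = m} {cs} {F} {ds} s = ++-unique
  (properInsertions-unique (node 1 cs ∷ F) (Split.k∉ s))
  (map-unique (proj₂ ∘ node-injective ∘ ∷-injectiveˡ)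
    (insertions-unique ds (Split.k∉′ s ∘ there ∘ ∈-++⁺ˡ)))
  disjoint
  where
  disjoint : Disjoint (properInsertions (node (2 + m) ds) (node 1 cs ∷ F))
                      (map (λ us → node 1 us ∷ F) (insertions (node (2 + m) cs) ds))
  disjoint (G∈ , G∈′)
    with i , _ ← ∈-properInsertions⁻ (node 1 cs ∷ F) G∈
    with us , us∈ , refl ← ∈-map⁻ (λ us → node 1 us ∷ F) G∈′
    -- A common result would force `cs` = `ds`, but `n` occurs only in `cs`.
    with refl ← trans (sym (extract-stay s i)) (extract-swap s (∈-insertions⁻ ds us∈)) =
    Split.n∉ds s (Split.n∈ s)

-- With `c` labels outside the tree of k = 2 + `m` and `d` + 1 inside, the two kinds number 2`c` -
-- (k - 1) and 2`d` + 1, where `c` + `d` + 1 = `n`. The sum is first computed as `total`, without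
-- subtraction.
length-reattachments : ∀ {n m cs F ds} → Split n m cs F ds →
                       length (reattachments (2 + m) cs F ds) ≡ 2 * n ∸ (2 + m)
length-reattachments {n} {m} {cs} {F} {ds} (split roots perm _) = begin
  ℓ                        ≡⟨ m+n∸n≡m ℓ (2 + m) ⟨
  ℓ + (2 + m) ∸ (2 + m)    ≡⟨ cong (_∸ (2 + m)) total ⟩
  2 * n ∸ (2 + m)          ∎
  where
  open ≡-Reasoning
  T = node (2 + m) ds
  ℓ = length (reattachments (2 + m) cs F ds)
  p = length (properInsertions T (node 1 cs ∷ F))
  c = length (labels (node 1 cs ∷ F))
  d = length (labels ds)

  length-F : length F ≡ m
  length-F = trans (sym (length-map root F)) (trans (cong length roots) (length-applyUpTo (2 +_) m))

  size : suc d + c ≡ n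
  size = trans (sym (length-++ (treeLabels T))) (trans (↭-length perm) (length-applyUpTo suc n))

  ℓ≡ : ℓ ≡ p + (1 + 2 * d)
  ℓ≡ = trans (length-++ (properInsertions T (node 1 cs ∷ F)))
         (cong (p +_) (trans (length-map _ (insertions (node (2 + m) cs) ds)) (length-insertions _ ds)))

  total : ℓ + (2 + m) ≡ 2 * n
  total = begin
    ℓ + (2 + m)                            ≡⟨ cong₂ (λ a b → a + (2 + b)) ℓ≡ (sym length-F) ⟩
    p + (1 + 2 * d) + (2 + length F)       ≡⟨ solve 3 (λ p d f → p :+ (con 1 :+ con 2 :* d) :+ (con 2 :+ f)
                                                := (p :+ (con 1 :+ f)) :+ con 2 :* (con 1 :+ d))
                                                refl p d (length F) ⟩
    (p + suc (length F)) + 2 * suc d       ≡⟨ cong (_+ 2 * suc d) (length-properInsertions T (node 1 cs ∷ F)) ⟩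
    2 * c + 2 * suc d                      ≡⟨ solve 2 (λ c d → con 2 :* c :+ con 2 :* d := con 2 :* (d :+ c))
                                                refl c (suc d) ⟩
    2 * (suc d + c)                        ≡⟨ cong (2 *_) size ⟩
    2 * n                                  ∎

-- The forests with one root fewer are partitioned according to the forest that cutting at 2 + `m`
-- leads to, and all classes have the same size.
reattach-enum : ∀ {n m} → 2 + m < n → (e : Enum (Anchored n (suc m))) →
                Σ (Enum (Anchored n m)) λ e′ → length (list e′) ≡ (2 * n ∸ (2 + m)) * length (list e)
reattach-enum {n} {m} k<n e = record
  { list     = concatMap f (list e)
  ; unique   = concatMap-unique f (unique e) f-unique f-disjoint
  ; sound    = λ G∈ → case find (∈-concatMap⁻ f G∈) of λ (H , H∈ , G∈f) → f-sound H∈ G∈f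
  ; complete = f-complete
  } , length-concatMap f (list e) f-length
  where
  f = reattach (2 + m)

  f-unique : ∀ {H} → H ∈ list e → Unique (f H)
  f-unique H∈ with cs , F , ds , refl , s ← anchored⇒split (sound e H∈)
    rewrite reattach-join (2 + m) cs F ds = reattachments-unique s

  f-length : ∀ {H} → H ∈ list e → length (f H) ≡ 2 * n ∸ (2 + m)
  f-length H∈ with cs , F , ds , refl , s ← anchored⇒split (sound e H∈)
    rewrite reattach-join (2 + m) cs F ds = length-reattachments s

  f-sound : ∀ {H G} → H ∈ list e → G ∈ f H → Anchored n m G
  f-sound H∈ G∈ with cs , F , ds , refl , s ← anchored⇒split (sound e H∈)
    rewrite reattach-join (2 + m) cs F ds = reattached-anchored s (∈-reattachments⁻ G∈)

  f-disjoint : ∀ {H H′ G} → H ∈ list e → H′ ∈ list e → G ∈ f H → G ∈ f H′ → H ≡ H′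
  f-disjoint H∈ H′∈ G∈ G∈′
    with cs , F , ds , refl , s ← anchored⇒split (sound e H∈)
       | cs′ , F′ , ds′ , refl , s′ ← anchored⇒split (sound e H′∈)
    rewrite reattach-join (2 + m) cs F ds | reattach-join (2 + m) cs′ F′ ds′
    with refl ← reattached-injective s s′ (∈-reattachments⁻ G∈) (∈-reattachments⁻ G∈′) = refl

  f-complete : ∀ {G} → Anchored n m G → G ∈ concatMap f (list e)
  f-complete a with cs , F , ds , s , r ← anchored-reattached k<n a =
    ∈-concatMap⁺ f (lose (complete e (split⇒anchored s))
      (subst (_ ∈_) (sym (reattach-join (2 + m) cs F ds)) (∈-reattachments⁺ r)))

-- The case k = n − 1, with a single forest

leaf : ℕ → PlaneTree
leaf x = node x []

length≤length-labels : ∀ F → length F ≤ length (labels F)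
length≤length-labels []              = z≤n
length≤length-labels (node x ts ∷ F) = s≤s (≤-trans (length≤length-labels F)
  (≤-trans (m≤n+m _ _) (≤-reflexive (sym (length-++ (labels ts))))))

-- The roots use up all the labels, which leaves none for children.
length-labels≤length⇒leaves : ∀ F → length (labels F) ≤ length F → F ≡ map leaf (map root F)
length-labels≤length⇒leaves []                         _         = refl
length-labels≤length⇒leaves (node x []       ∷ F) (s≤s le) =
  cong (_ ∷_) (length-labels≤length⇒leaves F le)
length-labels≤length⇒leaves (node x (node y ts ∷ us) ∷ F) (s≤s le) =
  contradiction (≤-trans (s≤s (length≤length-labels F)) (≤-trans longer le)) (<-irrefl refl)
  where
  longer : suc (length (labels F)) ≤ length (labels (node y ts ∷ us) ++ labels F)
  longer = s≤s (≤-trans (m≤n+m _ _) (≤-reflexive (sym (length-++ (labels ts ++ labels us)))))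

labels-leaves : ∀ xs → labels (map leaf xs) ≡ xs
labels-leaves []       = refl
labels-leaves (x ∷ xs) = cong (x ∷_) (labels-leaves xs)

roots-leaves : ∀ xs → map root (map leaf xs) ≡ xs
roots-leaves []       = refl
roots-leaves (x ∷ xs) = cong (x ∷_) (roots-leaves xs)

single : ∀ {n cs} → n ∈ labels cs → length (labels cs) ≤ 1 → cs ≡ [ leaf n ]
single {cs = node _ [] ∷ []} (here refl) _ = refl
single {cs = node _ [] ∷ node _ _ ∷ _} _ (s≤s ())
single {cs = node _ (node _ _ ∷ _) ∷ _} _ (s≤s ())

-- All vertices but `n` = 2 + `m` are roots, and `n` has to be the only child of 1.
base-enum : ∀ m → Enum (Anchored (2 + m) m)
base-enum m = record
  { list     = [ node 1 [ leaf (2 + m) ] ∷ map leaf xs ]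
  ; unique   = [] ∷ []
  ; sound    = λ { (here refl) → anchored (roots-leaves xs) perm (here refl) }
  ; complete = λ { (anchored roots perm′ n∈) → here (only roots perm′ n∈) }
  }
  where
  xs = applyUpTo (2 +_) m

  perm : 1 ∷ (2 + m) ∷ labels (map leaf xs) ↭ [1… 2 + m ]
  perm = prep 1 (begin
    (2 + m) ∷ labels (map leaf xs)   ≡⟨ cong ((2 + m) ∷_) (labels-leaves xs) ⟩
    (2 + m) ∷ xs                     ↭⟨ ∷↭∷ʳ (2 + m) xs ⟩
    xs ∷ʳ (2 + m)                    ≡⟨ applyUpTo-∷ʳ (2 +_) m ⟩
    applyUpTo (2 +_) (suc m)         ∎)
    where open PermutationReasoning

  only : ∀ {cs F} → map root F ≡ xs → 1 ∷ labels cs ++ labels F ↭ [1… 2 + m ] → 2 + m ∈ labels cs →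
         node 1 cs ∷ F ≡ node 1 [ leaf (2 + m) ] ∷ map leaf xs
  only {cs} {F} roots perm′ n∈ = cong₂ (λ us H → node 1 us ∷ H)
    -- The roots of `F` take `m` of the 1 + `m` labels other than 1, so at most one remains below 1.
    (single n∈ (+-cancelʳ-≤ m _ 1 (begin
      length (labels cs) + m                     ≡⟨ cong (length (labels cs) +_) length-F ⟨
      length (labels cs) + length F              ≤⟨ +-monoʳ-≤ _ (length≤length-labels F) ⟩
      length (labels cs) + length (labels F)     ≡⟨ size ⟩
      1 + m                                      ∎)))
    -- Conversely `n` takes one label below 1, so `F` has no more labels than trees.
    (trans (length-labels≤length⇒leaves F (≤-pred (begin
      1 + length (labels F)                      ≤⟨ +-monoˡ-≤ _ (∈-length n∈) ⟩
      length (labels cs) + length (labels F)     ≡⟨ size ⟩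
      1 + m                                      ≡⟨ cong suc length-F ⟨
      1 + length F                               ∎)))
      (cong (map leaf) roots))
    where
    open ≤-Reasoning
    length-F : length F ≡ m
    length-F = trans (sym (length-map root F)) (trans (cong length roots) (length-applyUpTo (2 +_) m))

    size : length (labels cs) + length (labels F) ≡ 1 + m
    size = trans (sym (length-++ (labels cs)))
      (suc-injective (trans (↭-length perm′) (length-applyUpTo suc (2 + m))))

-- Enumerations for every number of roots, and the theorem

anchored-enum : ∀ {n} m d → 2 + m + d ≡ n → Enum (Anchored n m)
anchored-enum m zero    refl = subst (λ n → Enum (Anchored n m)) (sym (+-identityʳ (2 + m))) (base-enum m)
-- `d` + 1 counts the vertices that are not roots. The recursion adds roots until only `n` is left
-- over.
anchored-enum m (suc d) refl = proj₁ (reattach-enum (m<m+n (2 + m) (s≤s z≤n))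
  (anchored-enum (suc m) d (sym (+-suc (2 + m) d))))

corollary4p1 : ∀ (n k : ℕ) → 2 ≤ k → k ≤ n ∸ 1 →
    ∃₂ λ (a b : ℕ) →
    (∣ 𝒫[ n ≺ 1 ] n (k ∸ 1) ∣≡ a) × (∣ 𝒫[ n ≺ 1 ] n k ∣≡ b) ×
    (a ≡ (2 * n ∸ k) * b)
corollary4p1 zero     k             2≤k k≤n∸1 = contradiction (≤-trans 2≤k k≤n∸1) λ ()
corollary4p1 (suc n′) (suc (suc m)) (s≤s (s≤s z≤n)) k≤n′ with d , refl ← m≤n⇒∃[o]m+o≡n k≤n′ =
  _ , _ , enum-card (descendants e′) , enum-card (descendants e) , length≡
  where
  -- With k = 2 + `m`, `e` enumerates the forests with k roots and `e′` those with k - 1.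
  e = anchored-enum (suc m) d refl
  step = reattach-enum (s≤s k≤n′) e
  e′ = proj₁ step
  length≡ = proj₂ step

  descendants : ∀ {l} → Enum (Anchored (suc n′) l) → Enum (λ F → IsForest (suc n′) (suc l) F × F ⊢ suc n′ ≺ 1)
  -- Here 2 ≤ k ≤ `n′`, so the vertex `suc n′` is at least 3 and differs from 1.
  descendants = enum-⇔ anchored⇒descends (descends⇒anchored λ ())
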